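{- For all rooted transition systems $\mathscr{M}$ and $\mathscr{N}$, there exists a functional bisimulation between $\mathscr{M}$ and $\mathscr{N}$ if and only if there exists a bi-interpretation of rooted transition systems between $\mathscr{M}$ and $\mathscr{N}$.
   Context: A rooted transition system $\mathscr{M}$ consists of a set $S_\mathscr{M}$ of states, a binary transition relation $\to$, and an initial state. A simulation $f:\mathscr{M}\to\mathscr{N}$ is a function $S_\mathscr{M}\to S_\mathscr{N}$ with $s\to s'$ implying $f(s)\to f(s')$ and mapping initial state to initial state. $\to^*$ is the reflexive-transitive closure of $\to$. Two states $s,t$ are path-equivalent, $s\sim t$, if for all states $u$: $s\to^*u\iff t\to^*u$ and $u\to^*s\iff u\to^*t$. A functional bisimulation between $\mathscr{M}$ and $\mathscr{N}$ is a pair of simulations $f:\mathscr{M}\to\mathscr{N}$, $g:\mathscr{N}\to\mathscr{M}$ with $gf(s)\sim_\mathscr{M} s$ for all $s\in S_\mathscr{M}$ and $fg(t)\sim_\mathscr{N}t$ for all $t\in S_\mathscr{N}$. A bi-interpretation of rooted transition systems between $\mathscr{M}$ and $\mathscr{N}$ is a pair of simulations $f:\mathscr{M}\to\mathscr{N}$, $g:\mathscr{N}\to\mathscr{M}$ such that for all $s\in S_\mathscr{M}$, $gf(s)\to^*s$ and $s\to^*gf(s)$, and for all $t\in S_\mathscr{N}$, $fg(t)\to^*t$ and $t\to^*fg(t)$. -}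

module Defs where

open import Data.Product using (_×_)
open import Function.Bundles using (_⇔_)
open import Level using (Level; _⊔_) renaming (suc to lsuc)
open import Relation.Binary.Construct.Closure.ReflexiveTransitive using (Star)
open import Relation.Binary.Core using (Rel)
open import Relation.Binary.PropositionalEquality using (_≡_)

private
  variable
    s t s′ t′ : Level

record RootedTransitionSystem (s t : Level) : Set (lsuc (s ⊔ t)) where
  infix 4 _⟶_ _⟶*_ _∼_
  field
    State   : Set s
    _⟶_     : Rel State t
    initial : State

  _⟶*_ : Rel State (s ⊔ t)
  _⟶*_ = Star _⟶_

  _∼_ : Rel State (s ⊔ t)
  x ∼ y = ∀ u → (x ⟶* u ⇔ y ⟶* u) × (u ⟶* x ⇔ u ⟶* y)

record Simulation (M : RootedTransitionSystem s t)
                  (N : RootedTransitionSystem s′ t′) :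
                  Set (s ⊔ t ⊔ s′ ⊔ t′) where
  private
    module M = RootedTransitionSystem M
    module N = RootedTransitionSystem N
  field
    map         : M.State → N.State
    map-⟶       : ∀ {x y} → x M.⟶ y → map x N.⟶ map y
    map-initial : map M.initial ≡ N.initial

record FunctionalBisimulation (M : RootedTransitionSystem s t)
                              (N : RootedTransitionSystem s′ t′) :
                              Set (s ⊔ t ⊔ s′ ⊔ t′) where
  private
    module M = RootedTransitionSystem M
    module N = RootedTransitionSystem N
  field
    f : Simulation M N
    g : Simulation N M
  private
    module f = Simulation f
    module g = Simulation g
  field
    gf∼id : ∀ x → g.map (f.map x) M.∼ x
    fg∼id : ∀ y → f.map (g.map y) N.∼ y

record BiInterpretation (M : RootedTransitionSystem s t)
                        (N : RootedTransitionSystem s′ t′) :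
                        Set (s ⊔ t ⊔ s′ ⊔ t′) where
  private
    module M = RootedTransitionSystem M
    module N = RootedTransitionSystem N
  field
    f : Simulation M N
    g : Simulation N M
  private
    module f = Simulation f
    module g = Simulation g
  field
    gf⟶*id : ∀ x → g.map (f.map x) M.⟶* x
    id⟶*gf : ∀ x → x M.⟶* g.map (f.map x)
    fg⟶*id : ∀ y → f.map (g.map y) N.⟶* y
    id⟶*fg : ∀ y → y N.⟶* f.map (g.map y)

{-# OPTIONS --safe #-}
module Submission where

open import Defs
open import Data.Product using (_,_; proj₁)
open import Function.Bundles using (_⇔_; mk⇔; module Equivalence)
open import Level using (Level)
open import Relation.Binary.Construct.Closure.ReflexiveTransitive using (ε; _◅◅_)

-- Path-equivalence is mutual reachability. Testing `x ∼ y` against the states `x` and `y`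
-- themselves, as in the Yoneda argument for preorders, yields paths both ways; conversely, such
-- paths carry all reachability to and from `x` over to `y` by transitivity. So both structures
-- impose equivalent conditions on the composites, and the same pair `f`, `g` serves for each.

module _ {s t : Level} (M : RootedTransitionSystem s t) where
  open RootedTransitionSystem M

  -- Take `u = y`: the empty path at `y` transfers to a path out of `x`.
  ∼⇒⟶* : ∀ {x y} → x ∼ y → x ⟶* y
  ∼⇒⟶* {y = y} x∼y = Equivalence.from (proj₁ (x∼y y)) ε

  ∼⇒*⟵ : ∀ {x y} → x ∼ y → y ⟶* x
  ∼⇒*⟵ {x} x∼y = Equivalence.to (proj₁ (x∼y x)) ε

  -- Paths out of one state are rerouted by prepending a connecting path, paths into it by appending
  -- one.
  ⟶*-antisym-∼ : ∀ {x y} → x ⟶* y → y ⟶* x → x ∼ y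
  ⟶*-antisym-∼ x⟶*y y⟶*x u =
    mk⇔ (y⟶*x ◅◅_) (x⟶*y ◅◅_) , mk⇔ (_◅◅ x⟶*y) (_◅◅ y⟶*x)

mainTheorem4 : ∀ {s t s′ t′ : Level} (M : RootedTransitionSystem s t) (N : RootedTransitionSystem s′ t′) →
    FunctionalBisimulation M N ⇔ BiInterpretation M N
mainTheorem4 M N = mk⇔ toBiInterpretation toBisimulation
  where
  toBiInterpretation : FunctionalBisimulation M N → BiInterpretation M N
  toBiInterpretation B = record
    { f = f
    ; g = g
    ; gf⟶*id = λ x → ∼⇒⟶* M (gf∼id x)
    ; id⟶*gf = λ x → ∼⇒*⟵ M (gf∼id x)
    ; fg⟶*id = λ y → ∼⇒⟶* N (fg∼id y)
    ; id⟶*fg = λ y → ∼⇒*⟵ N (fg∼id y)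
    }
    where open FunctionalBisimulation B

  toBisimulation : BiInterpretation M N → FunctionalBisimulation M N
  toBisimulation I = record
    { f = f
    ; g = g
    ; gf∼id = λ x → ⟶*-antisym-∼ M (gf⟶*id x) (id⟶*gf x)
    ; fg∼id = λ y → ⟶*-antisym-∼ N (fg⟶*id y) (id⟶*fg y)
    }
    where open BiInterpretation I
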